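{- Let $Sp$ be an unbalanced split graph. Then: (1) $W(Sp)=\{v\in V(Sp):\deg_{Sp}(v)=\omega(Sp)-1\}$. (2) $W(Sp)$ is a clique or an independent set of mutually twin vertices. (3) If $W(Sp)=\{w\}$, then $\operatorname{Supp}(Sp)\subseteq S^*(Sp)\cup\{w\}$. (4) If $W(Sp)$ is a clique of size $\ge 2$, then $\operatorname{Supp}(Sp)\subseteq S^*(Sp)$; in particular, $W(Sp)\cap\operatorname{Supp}(Sp)=\varnothing$. (5) If $W(Sp)$ is an independent set of size $\ge 2$, then $W(Sp)\subseteq\operatorname{Supp}(Sp)\subseteq S^*(Sp)\cup W(Sp)$.
   Context: Graphs are finite and simple. A split graph is a graph $Sp$ with at least one vertex whose vertex set is a disjoint union of a clique $K$ and an independent set $S$; such a pair $(K,S)$ is called an s-partition for $Sp$ (here one of the two parts may be empty). $\omega(Sp)$ and $\alpha(Sp)$ are the clique number and independence number. A split graph with s-partition $(K,S)$ is balanced if $|K|=\omega(Sp)$ and $|S|=\alpha(Sp)$, and unbalanced otherwise (this does not depend on the s-partition chosen). A vertex $w$ is swing if there exist s-partitions $(K,S)$, $(K',S')$ for $Sp$ with $w\in K$ and $w\in S'$; $W(Sp)$ is the set of swing vertices. $S^*(Sp)$ is the intersection of all independent sets $S$ such that $(K,S)$ is an s-partition for $Sp$ for some $K$. Vertices $u,v$ of a graph $G$ are twins if $N_G(u)\setminus\{v\}=N_G(v)\setminus\{u\}$, where $N_G$ denotes the (open) neighborhood. $\operatorname{Supp}(Sp)$ is the set of vertices $v$ such that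 $x_v\ne 0$ for some real vector $x$ in the nullspace of the adjacency matrix of $Sp$. -}

module Defs where

open import Algebra.Bundles using (RawMonoid)
import Algebra.Definitions.RawMonoid as RawMonoidDefs
open import Data.Bool.Base using (if_then_else_)
open import Data.Fin.Base using (Fin)
open import Data.Fin.Properties using (all?; _≟_)
open import Data.Fin.Subset using (Subset; inside; outside; ⊤; ⊥; _∈_; _∩_; _∪_; ⋂; _-_; ∣_∣)
open import Data.Fin.Subset.Properties using (_∈?_; anySubset?)
open import Data.List.Base using (List; []; _∷_; _++_; map; filter)
open import Data.List.Extrema.Nat using (max)
open import Data.Nat.Base as ℕ using (ℕ; zero; suc)
import Data.Nat.Properties as ℕ
open import Data.Product.Base using (∃; ∃₂; _×_; _,_)
open import Data.Rational.Base using (ℚ; 0ℚ; ½; _+_; _*_; _<_) renaming (_-_ to _-ℚ_; ∣_∣ to ∣_∣ℚ)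
open import Data.Rational.Properties
  using (∣p+q∣≤∣p∣+∣q∣; +-mono-<; *-distribʳ-+; *-identityˡ; *-zeroʳ; *-monoʳ-<-pos; module ≤-Reasoning)
import Data.Rational.Solver as ℚ
open import Data.Vec.Base using (tabulate; []; _∷_)
import Data.Vec.Properties as Vec
import Data.Bool.Properties as Bool
open import Data.Vec.Functional using (Vector)
open import Level using (0ℓ)
open import Relation.Binary.Core using (Rel)
open import Relation.Binary.Definitions using (Decidable; Symmetric; Irreflexive)
open import Relation.Binary.PropositionalEquality using (_≡_; _≢_; refl; sym; subst; cong)
open import Relation.Nullary.Decidable using (does; ¬?; _×-dec_; _→-dec_)
open import Relation.Nullary.Negation using (¬_)
import Relation.Nullary.Decidable as Dec
import Relation.Unary as U

-- Real numbers: rational Cauchy sequences up to the equality _≃_.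

record ℝ : Set where
  constructor mkℝ
  field
    approx : ℕ → ℚ
    cauchy : ∀ ε → 0ℚ < ε →
             ∃ λ N → ∀ i j → N ℕ.≤ i → N ℕ.≤ j → ∣ approx i -ℚ approx j ∣ℚ < ε

open ℝ public

infix 4 _≃_

_≃_ : Rel ℝ 0ℓ
x ≃ y = ∀ ε → 0ℚ < ε →
        ∃ λ N → ∀ i → N ℕ.≤ i → ∣ approx x i -ℚ approx y i ∣ℚ < ε

0ℝ : ℝ
0ℝ = mkℝ (λ _ → 0ℚ) (λ ε 0<ε → 0 , λ _ _ _ _ → 0<ε)

private
  0<½*ε : ∀ ε → 0ℚ < ε → 0ℚ < ½ * ε
  0<½*ε ε 0<ε = subst (_< ½ * ε) (*-zeroʳ ½) (*-monoʳ-<-pos ½ 0<ε)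

  ½*ε+½*ε≡ε : ∀ ε → ½ * ε + ½ * ε ≡ ε
  ½*ε+½*ε≡ε ε = begin-equality
    ½ * ε + ½ * ε  ≡⟨ sym (*-distribʳ-+ ε ½ ½) ⟩
    (½ + ½) * ε    ≡⟨ *-identityˡ ε ⟩
    ε              ∎
    where open ≤-Reasoning

  interchange : ∀ a b c d → (a + b) -ℚ (c + d) ≡ (a -ℚ c) + (b -ℚ d)
  interchange = solve 4 (λ a b c d → (a :+ b) :- (c :+ d) := (a :- c) :+ (b :- d)) refl
    where open ℚ.+-*-Solver

infixl 6 _+ℝ_

_+ℝ_ : ℝ → ℝ → ℝ
approx (x +ℝ y) i = approx x i + approx y i
cauchy (x +ℝ y) ε 0<ε
  with M , x-cauchy ← cauchy x (½ * ε) (0<½*ε ε 0<ε)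
     | N , y-cauchy ← cauchy y (½ * ε) (0<½*ε ε 0<ε)
  = M ℕ.⊔ N , λ i j M⊔N≤i M⊔N≤j → begin-strict
    ∣ (approx x i + approx y i) -ℚ (approx x j + approx y j) ∣ℚ
      ≡⟨ cong ∣_∣ℚ (interchange (approx x i) (approx y i) (approx x j) (approx y j)) ⟩
    ∣ (approx x i -ℚ approx x j) + (approx y i -ℚ approx y j) ∣ℚ
      ≤⟨ ∣p+q∣≤∣p∣+∣q∣ (approx x i -ℚ approx x j) (approx y i -ℚ approx y j) ⟩
    ∣ approx x i -ℚ approx x j ∣ℚ + ∣ approx y i -ℚ approx y j ∣ℚ
      <⟨ +-mono-< (x-cauchy i j (ℕ.m⊔n≤o⇒m≤o M N M⊔N≤i) (ℕ.m⊔n≤o⇒m≤o M N M⊔N≤j))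
                  (y-cauchy i j (ℕ.m⊔n≤o⇒n≤o M N M⊔N≤i) (ℕ.m⊔n≤o⇒n≤o M N M⊔N≤j)) ⟩
    ½ * ε + ½ * ε
      ≡⟨ ½*ε+½*ε≡ε ε ⟩
    ε ∎
    where open ≤-Reasoning

ℝ-+-rawMonoid : RawMonoid 0ℓ 0ℓ
ℝ-+-rawMonoid = record { Carrier = ℝ ; _≈_ = _≃_ ; _∙_ = _+ℝ_ ; ε = 0ℝ }

open RawMonoidDefs ℝ-+-rawMonoid public using (sum) renaming (_×_ to _·_)

subsets : ∀ n → List (Subset n)
subsets zero    = [] ∷ []
subsets (suc n) = map (inside ∷_) (subsets n) ++ map (outside ∷_) (subsets n)

⟪_⟫ : ∀ {n} {P : U.Pred (Fin n) 0ℓ} → U.Decidable P → Subset n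
⟪ P? ⟫ = tabulate (λ v → does (P? v))

record Graph (n : ℕ) : Set₁ where
  infix 4 _~_ _~?_
  field
    _~_      : Rel (Fin n) 0ℓ
    _~?_     : Decidable _~_
    ~-sym    : Symmetric _~_
    ~-irrefl : Irreflexive _≡_ _~_

module _ {n : ℕ} (G : Graph n) where
  open Graph G

  N : Fin n → Subset n
  N v = ⟪ v ~?_ ⟫

  deg : Fin n → ℕ
  deg v = ∣ N v ∣

  Twins : Rel (Fin n) 0ℓ
  Twins u v = N u - v ≡ N v - u

  IsClique : Subset n → Set
  IsClique K = ∀ u v → u ∈ K → v ∈ K → u ≢ v → u ~ v

  IsIndependent : Subset n → Set
  IsIndependent S = ∀ u v → u ∈ S → v ∈ S → ¬ (u ~ v)

  isClique? : U.Decidable IsClique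
  isClique? K = all? λ u → all? λ v →
    (u ∈? K) →-dec (v ∈? K) →-dec ¬? (u ≟ v) →-dec (u ~? v)

  isIndependent? : U.Decidable IsIndependent
  isIndependent? S = all? λ u → all? λ v →
    (u ∈? S) →-dec (v ∈? S) →-dec ¬? (u ~? v)

  ω : ℕ
  ω = max 0 (map ∣_∣ (filter isClique? (subsets n)))

  α : ℕ
  α = max 0 (map ∣_∣ (filter isIndependent? (subsets n)))

  record IsSPartition (K S : Subset n) : Set where
    constructor mkIsSPartition
    field
      covers      : K ∪ S ≡ ⊤
      disjoint    : K ∩ S ≡ ⊥
      clique      : IsClique K
      independent : IsIndependent S

  isSPartition? : Decidable IsSPartition
  isSPartition? K S = Dec.map′
      (λ (c , d , k , s) → mkIsSPartition c d k s)
      (λ (mkIsSPartition c d k s) → c , d , k , s)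
      ((K ∪ S ≟ˢ ⊤) ×-dec (K ∩ S ≟ˢ ⊥) ×-dec isClique? K ×-dec isIndependent? S)
    where
    infix 4 _≟ˢ_
    _≟ˢ_ : Decidable {A = Subset n} _≡_
    _≟ˢ_ = Vec.≡-dec Bool._≟_

  record IsSplitGraph : Set where
    field
      nonempty   : 0 ℕ.< n
      K S        : Subset n
      sPartition : IsSPartition K S

  -- Read off the s-partition carried by the split graph; the answer does
  -- not depend on it.
  Balanced : IsSplitGraph → Set
  Balanced sp = ∣ K ∣ ≡ ω × ∣ S ∣ ≡ α
    where open IsSplitGraph sp

  Unbalanced : IsSplitGraph → Set
  Unbalanced sp = ¬ Balanced sp

  IsSwing : Fin n → Set
  IsSwing w = ∃₂ λ K S → ∃₂ λ K′ S′ →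
    IsSPartition K S × IsSPartition K′ S′ × w ∈ K × w ∈ S′

  isSwing? : U.Decidable IsSwing
  isSwing? w =
    anySubset? λ K → anySubset? λ S → anySubset? λ K′ → anySubset? λ S′ →
      isSPartition? K S ×-dec isSPartition? K′ S′ ×-dec (w ∈? K) ×-dec (w ∈? S′)

  W : Subset n
  W = ⟪ isSwing? ⟫

  S* : Subset n
  S* = ⋂ (filter (λ S → anySubset? λ K → isSPartition? K S) (subsets n))

  adjacency : Fin n → Fin n → ℕ
  adjacency u v = if does (u ~? v) then 1 else 0

  -- Adjacency entries are 0 or 1, so the products in the matrix-vector
  -- product are taken as natural multiples of reals.
  IsNull : Vector ℝ n → Set
  IsNull x = ∀ u → sum (λ v → adjacency u v · x v) ≃ 0ℝ

  Supp : U.Pred (Fin n) 0ℓ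
  Supp v = ∃ λ (x : Vector ℝ n) → IsNull x × ¬ (x v ≃ 0ℝ)

{-# OPTIONS --safe #-}
module Submission where

-- An unbalanced split graph has an s-partition (K, S) with a vertex y ∈ K that
-- has no neighbour in S. Then |K| = ω, and the swing vertices are the members
-- of K without neighbours in S together with the v ∈ S with N v = K - y; these
-- two kinds exclude each other except for y itself.
-- For the supports, let A x = 0 and s = Σ_K x. Subtracting Σ_S x_u (Ax)_u from
-- Σ_K x_u (Ax)_u cancels the edges between K and S and leaves s² = Σ_K x_u²,
-- while row y says s = x_y. So x vanishes on K - y. A vertex of S outside S* is
-- swing, and e_w - e_w′ is null when w and w′ have equal neighbourhoods.
-- The real numbers being Cauchy sequences, this is carried out on rational
-- approximations, with an error that tends to 0.

open import Defs
import Algebra.Properties.Semiring.Sum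
open import Algebra.Bundles using (CommutativeRing)
open import Data.Bool.Base using (if_then_else_; true; false)
open import Data.Fin.Base using (Fin; zero; suc)
import Data.Fin.Properties as Fin
open import Data.Fin.Subset
  using (Subset; inside; outside; _∈_; _∉_; _⊆_; _∪_; ⋂; ⁅_⁆; ∣_∣)
  renaming (_-_ to _∖_)
open import Data.Fin.Subset.Properties
  using (_∈?_; ∈⊤; ⊆⊤; ∉⊥; ⊥⊆; ⊆-antisym; x∈⁅x⁆; x∈⁅y⁆⇒x≡y; ∣⁅x⁆∣≡1; x∈p∪q⁻; x∈p∪q⁺; x∈p∩q⁻; x∈p∩q⁺;
         p─q⊆p; p─⊥≡p; p─x─y≡p─y─x; x∈p∧x≢y⇒x∈p-y; p⊆q⇒∣p∣≤∣q∣; p⊂q⇒∣p∣<∣q∣; anySubset?)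
open import Data.List.Base using ([]; _∷_; map; filter)
open import Data.List.Extrema.Nat using (max; max≈v⁺)
open import Data.List.Membership.Propositional using () renaming (_∈_ to _∈ˡ_)
open import Data.List.Membership.Propositional.Properties using (∈-map⁺; ∈-++⁺ˡ; ∈-++⁺ʳ; ∈-filter⁺; ∈-filter⁻)
open import Data.List.Relation.Unary.All using (tabulate)
import Data.List.Relation.Unary.All.Properties as All
open import Data.List.Relation.Unary.Any using (here; there)
open import Data.Nat.Base as ℕ using (ℕ; zero; suc; _≤_; _∸_; z≤n; s≤s)
import Data.Nat.Properties as ℕ
open import Data.Product.Base using (∃; ∃₂; _×_; _,_; proj₂)
open import Data.Rational.Base as ℚ
  using (ℚ; 0ℚ; 1ℚ; ½; _+_; _*_; _-_; -_; 1/_; NonNegative; positive; nonNegative)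
  renaming (_≤_ to _≤ℚ_; _<_ to _<ℚ_; ∣_∣ to ∣_∣ℚ)
import Data.Rational.Properties as ℚ
open import Data.Rational.Solver using (module +-*-Solver)
open import Data.Sum.Base using (_⊎_; inj₁; inj₂; fromInj₁)
open import Data.Vec.Base using ([]; _∷_; here; there; lookup)
open import Data.Vec.Functional using (Vector)
open import Data.Vec.Properties using (lookup∘tabulate; lookup⇒[]=; []=⇒lookup)
open import Function.Base using (_∘_)
open import Function.Bundles using (_⇔_; mk⇔)
open import Level using (0ℓ)
open import Relation.Binary.PropositionalEquality
open import Relation.Nullary.Decidable using (Dec; does; yes; no; dec-true; dec-false; ¬?; _×-dec_; _→-dec_; decidable-stable)
open import Relation.Nullary.Negation using (¬_; contradiction)
import Relation.Unary as U

open Algebra.Properties.Semiring.Sum (CommutativeRing.semiring ℚ.+-*-commutativeRing)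
  using (sum-cong-≗; sum-replicate-zero; ∑-distrib-+; ∑-comm; *-distribˡ-sum; *-distribʳ-sum)
  renaming (sum to ∑)

-- Finite subsets: deletion, counting and exchange.

2≤∣p∣⇒∃≢ : ∀ {n} {p : Subset n} → 2 ≤ ∣ p ∣ → ∀ x → ∃ λ y → y ∈ p × y ≢ x
2≤∣p∣⇒∃≢ {p = p} 2≤∣p∣ x = decidable-stable (Fin.any? λ y → y ∈? p ×-dec ¬? (y Fin.≟ x)) λ p⊆x →
  ℕ.<⇒≱ 2≤∣p∣ (subst (∣ p ∣ ≤_) (∣⁅x⁆∣≡1 x) (p⊆q⇒∣p∣≤∣q∣ λ {y} y∈p →
    subst (_∈ ⁅ x ⁆) (sym (decidable-stable (y Fin.≟ x) λ y≢x → p⊆x (y , y∈p , y≢x))) (x∈⁅x⁆ x)))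

module _ {n} {P : U.Pred (Fin n) 0ℓ} (P? : U.Decidable P) where

  ∈⟪⟫⁺ : ∀ {v} → P v → v ∈ ⟪ P? ⟫
  ∈⟪⟫⁺ {v} Pv = lookup⇒[]= v _ (trans (lookup∘tabulate _ v) (dec-true (P? v) Pv))

  ∈⟪⟫⁻ : ∀ {v} → v ∈ ⟪ P? ⟫ → P v
  ∈⟪⟫⁻ {v} v∈ with P? v | trans (sym (lookup∘tabulate (does ∘ P?) v)) ([]=⇒lookup v∈)
  ... | yes Pv | _ = Pv

x∉p-x : ∀ {n} {p : Subset n} {x} → x ∉ p ∖ x
x∉p-x {p = _ ∷ _} {zero}  ()
x∉p-x {p = _ ∷ p} {suc x} (there x∈) = x∉p-x {p = p} x∈

x∈p-y⇒x∈p : ∀ {n} {p : Subset n} {x y} → x ∈ p ∖ y → x ∈ p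
x∈p-y⇒x∈p {p = p} = p─q⊆p p _

x∈p-y⇒x≢y : ∀ {n} {p : Subset n} {x y} → x ∈ p ∖ y → x ≢ y
x∈p-y⇒x≢y {p = p} x∈p-y refl = x∉p-x {p = p} x∈p-y

x∉p⇒p-x≡p : ∀ {n} {p : Subset n} {x} → x ∉ p → p ∖ x ≡ p
x∉p⇒p-x≡p {p = p} x∉p = ⊆-antisym (x∈p-y⇒x∈p {p = p}) λ u∈p → x∈p∧x≢y⇒x∈p-y u∈p λ { refl → x∉p u∈p }

x∈p⇒∣p∣≡1+∣p-x∣ : ∀ {n} {p : Subset n} {x} → x ∈ p → ∣ p ∣ ≡ suc ∣ p ∖ x ∣
x∈p⇒∣p∣≡1+∣p-x∣ {p = inside  ∷ p} here        = cong (suc ∘ ∣_∣) (sym (p─⊥≡p p))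
x∈p⇒∣p∣≡1+∣p-x∣ {p = inside  ∷ p} (there x∈p) = cong suc (x∈p⇒∣p∣≡1+∣p-x∣ x∈p)
x∈p⇒∣p∣≡1+∣p-x∣ {p = outside ∷ p} (there x∈p) = x∈p⇒∣p∣≡1+∣p-x∣ x∈p

p⊆q∧∣q∣≤∣p∣⇒q⊆p : ∀ {n} {p q : Subset n} → p ⊆ q → ∣ q ∣ ≤ ∣ p ∣ → q ⊆ p
p⊆q∧∣q∣≤∣p∣⇒q⊆p {p = p} p⊆q ∣q∣≤∣p∣ {x} x∈q with x ∈? p
... | yes x∈p = x∈p
... | no x∉p  = contradiction ∣q∣≤∣p∣ (ℕ.<⇒≱ (p⊂q⇒∣p∣<∣q∣ (p⊆q , x , x∈q , x∉p)))

∣exchange∣ : ∀ {n} {p q : Subset n} {x y} → x ∈ p → y ∈ q → p ∖ x ⊆ q ∖ y → ∣ p ∣ ≤ ∣ q ∣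
∣exchange∣ x∈p y∈q p-x⊆q-y = subst₂ _≤_ (sym (x∈p⇒∣p∣≡1+∣p-x∣ x∈p)) (sym (x∈p⇒∣p∣≡1+∣p-x∣ y∈q))
  (s≤s (p⊆q⇒∣p∣≤∣q∣ p-x⊆q-y))

∈-subsets : ∀ {n} (p : Subset n) → p ∈ˡ subsets n
∈-subsets []            = here refl
∈-subsets (inside  ∷ p) = ∈-++⁺ˡ (∈-map⁺ _ (∈-subsets p))
∈-subsets (outside ∷ p) = ∈-++⁺ʳ _ (∈-map⁺ _ (∈-subsets p))

x∉⋂⇒∃ : ∀ {n} {x : Fin n} ps → x ∉ ⋂ ps → ∃ λ p → p ∈ˡ ps × x ∉ p
x∉⋂⇒∃ []               x∉ = contradiction ∈⊤ x∉
x∉⋂⇒∃ {x = x} (p ∷ ps) x∉ with x ∈? p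
... | no x∉p = p , here refl , x∉p
... | yes x∈p with q , q∈ps , x∉q ← x∉⋂⇒∃ ps (λ x∈ → x∉ (x∈p∩q⁺ (x∈p , x∈))) = q , there q∈ps , x∉q

-- Identifies `ω` and `α`, which are maxima over filtered lists, with the size of one explicit
-- optimal set.
max-size : ∀ {n} {P : U.Pred (Subset n) 0ℓ} (P? : U.Decidable P) {p} →
  P p → (∀ q → P q → ∣ q ∣ ≤ ∣ p ∣) → max 0 (map ∣_∣ (filter P? (subsets n))) ≡ ∣ p ∣
max-size P? {p} Pp bound = max≈v⁺ (∈-map⁺ ∣_∣ (∈-filter⁺ P? (∈-subsets p) Pp))
  (All.map⁺ (tabulate λ {q} q∈ → bound q (proj₂ (∈-filter⁻ P? {xs = subsets _} q∈)))) z≤n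

-- Trade the only element of q outside p for an element of p that q misses.
∣∣≤-by-exchange : ∀ {n} {p q : Subset n} →
  (∀ {x y} → x ∈ q → x ∉ p → y ∈ q → y ∉ p → x ≡ y) →
  (∀ {x} → x ∈ q → x ∉ p → ∃ λ y → y ∈ p × y ∉ q) → ∣ q ∣ ≤ ∣ p ∣
∣∣≤-by-exchange {p = p} {q} unique missing with Fin.any? (λ x → x ∈? q ×-dec ¬? (x ∈? p))
... | no q⊆p = p⊆q⇒∣p∣≤∣q∣ λ {x} x∈q → decidable-stable (x ∈? p) λ x∉p → q⊆p (x , x∈q , x∉p)
... | yes (x , x∈q , x∉p) with y , y∈p , y∉q ← missing x∈q x∉p =
  ∣exchange∣ x∈q y∈p λ {z} z∈q-x → let z∈q = x∈p-y⇒x∈p {p = q} z∈q-x in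
    x∈p∧x≢y⇒x∈p-y
      (decidable-stable (z ∈? p) λ z∉p → x∈p-y⇒x≢y {p = q} z∈q-x (unique z∈q z∉p x∈q x∉p))
      λ { refl → y∉q z∈q }

-- Moving vertices between the two sides of an s-partition.

module _ {n} (G : Graph n) where
  open Graph G

  ∈N⁺ : ∀ {u v} → u ~ v → v ∈ N G u
  ∈N⁺ = ∈⟪⟫⁺ (_ ~?_)

  ∈N⁻ : ∀ {u v} → v ∈ N G u → u ~ v
  ∈N⁻ = ∈⟪⟫⁻ (_ ~?_)

  -- The vertex w of the clique side could be moved to the independent side.
  record Pivot (K S : Subset n) (w : Fin n) : Set where
    constructor mkPivot
    field
      part : IsSPartition G K S
      w∈K  : w ∈ K
      w≁S  : ∀ v → v ∈ S → ¬ w ~ v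

  module _ {K S} (part : IsSPartition G K S) where
    open IsSPartition part

    either : ∀ u → u ∈ K ⊎ u ∈ S
    either u = x∈p∪q⁻ K S (subst (u ∈_) (sym covers) ∈⊤)

    exclusive : ∀ {u} → u ∈ K → u ∉ S
    exclusive u∈K u∈S = ∉⊥ (subst (_ ∈_) disjoint (x∈p∩q⁺ (u∈K , u∈S)))

    ∉K⇒∈S : ∀ {u} → u ∉ K → u ∈ S
    ∉K⇒∈S {u} u∉K with either u
    ... | inj₁ u∈K = contradiction u∈K u∉K
    ... | inj₂ u∈S = u∈S

    ∉S⇒∈K : ∀ {u} → u ∉ S → u ∈ K
    ∉S⇒∈K {u} u∉S with either u
    ... | inj₁ u∈K = u∈K
    ... | inj₂ u∈S = contradiction u∈S u∉S

    -- Two vertices of `C` outside `K` would be adjacent members of `S`, so `C` has at most one. The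
    -- second hypothesis supplies the vertex of `K` to trade for it.
    clique-bound : ∀ {C} → IsClique G C → (∀ {x} → x ∈ C → x ∉ K → ∃ λ y → y ∈ K × y ∉ C) → ∣ C ∣ ≤ ∣ K ∣
    clique-bound C-clique = ∣∣≤-by-exchange λ {x} {y} x∈C x∉K y∈C y∉K →
      decidable-stable (x Fin.≟ y) λ x≢y →
        independent x y (∉K⇒∈S x∉K) (∉K⇒∈S y∉K) (C-clique x y x∈C y∈C x≢y)

    -- Dual to `clique-bound`: `I` has at most one vertex in the clique `K`.
    independent-bound : ∀ {I} → IsIndependent G I → (∀ {x} → x ∈ I → x ∉ S → ∃ λ y → y ∈ S × y ∉ I) → ∣ I ∣ ≤ ∣ S ∣
    independent-bound I-indep = ∣∣≤-by-exchange λ {x} {y} x∈I x∉S y∈I y∉S →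
      decidable-stable (x Fin.≟ y) λ x≢y →
        I-indep x y x∈I y∈I (clique x y (∉S⇒∈K x∉S) (∉S⇒∈K y∉S) x≢y)

    to-clique : ∀ {x} → x ∈ S → (∀ u → u ∈ K → x ~ u) → IsSPartition G (K ∪ ⁅ x ⁆) (S ∖ x)
    to-clique {x} x∈S x~K = mkIsSPartition
      (⊆-antisym ⊆⊤ λ {u} _ → cover u)
      (⊆-antisym (λ u∈ → let u∈K∪x , u∈S-x = x∈p∩q⁻ (K ∪ ⁅ x ⁆) (S ∖ x) u∈ in
                         contradiction u∈S-x (apart u∈K∪x)) ⊥⊆)
      (λ u v u∈ v∈ → adjacent (x∈p∪q⁻ K _ u∈) (x∈p∪q⁻ K _ v∈))
      (λ u v u∈ v∈ → independent u v (x∈p-y⇒x∈p {p = S} u∈) (x∈p-y⇒x∈p {p = S} v∈))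
      where
      cover : ∀ u → u ∈ (K ∪ ⁅ x ⁆) ∪ (S ∖ x)
      cover u with either u | u Fin.≟ x
      ... | inj₁ u∈K | _        = x∈p∪q⁺ (inj₁ (x∈p∪q⁺ (inj₁ u∈K)))
      ... | inj₂ u∈S | yes refl = x∈p∪q⁺ (inj₁ (x∈p∪q⁺ (inj₂ (x∈⁅x⁆ x))))
      ... | inj₂ u∈S | no u≢x   = x∈p∪q⁺ (inj₂ (x∈p∧x≢y⇒x∈p-y u∈S u≢x))
      apart : ∀ {u} → u ∈ K ∪ ⁅ x ⁆ → u ∉ S ∖ x
      apart u∈ u∈S-x with x∈p∪q⁻ K _ u∈
      ... | inj₁ u∈K = exclusive u∈K (x∈p-y⇒x∈p {p = S} u∈S-x)
      ... | inj₂ u∈x = x∈p-y⇒x≢y {p = S} u∈S-x (x∈⁅y⁆⇒x≡y x u∈x)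
      adjacent : ∀ {u v} → u ∈ K ⊎ u ∈ ⁅ x ⁆ → v ∈ K ⊎ v ∈ ⁅ x ⁆ → u ≢ v → u ~ v
      adjacent (inj₁ u∈K) (inj₁ v∈K) u≢v = clique _ _ u∈K v∈K u≢v
      adjacent (inj₁ u∈K) (inj₂ v∈x) u≢v rewrite x∈⁅y⁆⇒x≡y x v∈x = ~-sym (x~K _ u∈K)
      adjacent (inj₂ u∈x) (inj₁ v∈K) u≢v rewrite x∈⁅y⁆⇒x≡y x u∈x = x~K _ v∈K
      adjacent (inj₂ u∈x) (inj₂ v∈x) u≢v = contradiction (trans (x∈⁅y⁆⇒x≡y x u∈x) (sym (x∈⁅y⁆⇒x≡y x v∈x))) u≢v

    to-independent : ∀ {x} → x ∈ K → (∀ u → u ∈ S → ¬ x ~ u) → IsSPartition G (K ∖ x) (S ∪ ⁅ x ⁆)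
    to-independent {x} x∈K x≁S = mkIsSPartition
      (⊆-antisym ⊆⊤ λ {u} _ → cover u)
      (⊆-antisym (λ u∈ → let u∈K-x , u∈S∪x = x∈p∩q⁻ (K ∖ x) (S ∪ ⁅ x ⁆) u∈ in
                         contradiction u∈K-x (apart u∈S∪x)) ⊥⊆)
      (λ u v u∈ v∈ → clique u v (x∈p-y⇒x∈p {p = K} u∈) (x∈p-y⇒x∈p {p = K} v∈))
      (λ u v u∈ v∈ → nonadjacent (x∈p∪q⁻ S _ u∈) (x∈p∪q⁻ S _ v∈))
      where
      cover : ∀ u → u ∈ (K ∖ x) ∪ (S ∪ ⁅ x ⁆)
      cover u with either u | u Fin.≟ x
      ... | inj₂ u∈S | _        = x∈p∪q⁺ (inj₂ (x∈p∪q⁺ (inj₁ u∈S)))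
      ... | inj₁ u∈K | yes refl = x∈p∪q⁺ (inj₂ (x∈p∪q⁺ (inj₂ (x∈⁅x⁆ x))))
      ... | inj₁ u∈K | no u≢x   = x∈p∪q⁺ (inj₁ (x∈p∧x≢y⇒x∈p-y u∈K u≢x))
      apart : ∀ {u} → u ∈ S ∪ ⁅ x ⁆ → u ∉ K ∖ x
      apart u∈ u∈K-x with x∈p∪q⁻ S _ u∈
      ... | inj₁ u∈S = exclusive (x∈p-y⇒x∈p {p = K} u∈K-x) u∈S
      ... | inj₂ u∈x = x∈p-y⇒x≢y {p = K} u∈K-x (x∈⁅y⁆⇒x≡y x u∈x)
      nonadjacent : ∀ {u v} → u ∈ S ⊎ u ∈ ⁅ x ⁆ → v ∈ S ⊎ v ∈ ⁅ x ⁆ → ¬ u ~ v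
      nonadjacent (inj₁ u∈S) (inj₁ v∈S) = independent _ _ u∈S v∈S
      nonadjacent (inj₁ u∈S) (inj₂ v∈x) u~v rewrite x∈⁅y⁆⇒x≡y x v∈x = x≁S _ u∈S (~-sym u~v)
      nonadjacent (inj₂ u∈x) (inj₁ v∈S) rewrite x∈⁅y⁆⇒x≡y x u∈x = x≁S _ v∈S
      nonadjacent (inj₂ u∈x) (inj₂ v∈x) = ~-irrefl (trans (x∈⁅y⁆⇒x≡y x u∈x) (sym (x∈⁅y⁆⇒x≡y x v∈x)))

    -- Coming from the independent set `S`, the vertex `x` has no neighbour among the vertices left
    -- there.
    to-clique-pivot : ∀ {x} → x ∈ S → (∀ u → u ∈ K → x ~ u) → Pivot (K ∪ ⁅ x ⁆) (S ∖ x) x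
    to-clique-pivot {x} x∈S x~K = mkPivot (to-clique x∈S x~K) (x∈p∪q⁺ (inj₂ (x∈⁅x⁆ x)))
      λ v v∈S-x → independent x v x∈S (x∈p-y⇒x∈p {p = S} v∈S-x)

  -- A vertex of `K` without neighbours in `S` is a pivot at once, and a vertex of `S` adjacent to
  -- all of `K` becomes one after moving. If neither exists, both exchange bounds apply and the
  -- partition is balanced.
  ¬balanced⇒pivot : ∀ {K S} → IsSPartition G K S → ¬ (∣ K ∣ ≡ ω G × ∣ S ∣ ≡ α G) → ∃₂ λ K′ S′ → ∃ (Pivot K′ S′)
  ¬balanced⇒pivot {K} {S} part ¬balanced
    with Fin.any? (λ y → y ∈? K ×-dec Fin.all? (λ v → v ∈? S →-dec ¬? (y ~? v)))
       | Fin.any? (λ x → x ∈? S ×-dec Fin.all? (λ u → u ∈? K →-dec (x ~? u)))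
  ... | yes (y , y∈K , y≁S) | _ = K , S , y , mkPivot part y∈K y≁S
  ... | no _ | yes (x , x∈S , x~K) = _ , _ , x , to-clique-pivot part x∈S x~K
  ... | no ¬y | no ¬x = contradiction
    ( sym (max-size (isClique? G) clique λ C C-clique → clique-bound part C-clique (missed C-clique))
    , sym (max-size (isIndependent? G) independent λ I I-indep → independent-bound part I-indep (missed′ I-indep)))
    ¬balanced
    where
    open IsSPartition part
    -- If `C` contained all of `K`, then `x` would be a vertex of `S` adjacent to all of `K`,
    -- against `¬x`.
    missed : ∀ {C} → IsClique G C → ∀ {x} → x ∈ C → x ∉ K → ∃ λ y → y ∈ K × y ∉ C
    missed {C} C-clique {x} x∈C x∉K = decidable-stable (Fin.any? λ y → y ∈? K ×-dec ¬? (y ∈? C)) λ K⊆C →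
      ¬x (x , ∉K⇒∈S part x∉K , λ u u∈K → C-clique x u x∈C
        (decidable-stable (u ∈? C) λ u∉C → K⊆C (u , u∈K , u∉C)) λ { refl → x∉K u∈K })
    -- If `I` contained all of `S`, then `x` would be a vertex of `K` without neighbours in `S`,
    -- against `¬y`.
    missed′ : ∀ {I} → IsIndependent G I → ∀ {x} → x ∈ I → x ∉ S → ∃ λ y → y ∈ S × y ∉ I
    missed′ {I} I-indep {x} x∈I x∉S = decidable-stable (Fin.any? λ y → y ∈? S ×-dec ¬? (y ∈? I)) λ S⊆I →
      ¬y (x , ∉S⇒∈K part x∉S , λ v v∈S → I-indep x v x∈I
        (decidable-stable (v ∈? I) λ v∉I → S⊆I (v , v∈S , v∉I)))

  -- Pivots and swing vertices.

  module _ {K S w} (pivot : Pivot K S w) where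
    open Pivot pivot
    open IsSPartition part

    -- A clique with a vertex in `S` cannot contain `w`, so `w` is the vertex of `K` to exchange for
    -- it.
    pivot⇒∣K∣≡ω : ∣ K ∣ ≡ ω G
    pivot⇒∣K∣≡ω = sym (max-size (isClique? G) clique λ C C-clique → clique-bound part C-clique λ {x} x∈C x∉K →
      w , w∈K , λ w∈C → w≁S x (∉K⇒∈S part x∉K) (C-clique w x w∈C x∈C λ { refl → x∉K w∈K }))

    pivot⇒N≡ : N G w ≡ K ∖ w
    pivot⇒N≡ = ⊆-antisym
      (λ {u} u∈N → x∈p∧x≢y⇒x∈p-y
        (∉S⇒∈K part λ u∈S → w≁S u u∈S (∈N⁻ u∈N)) λ { refl → ~-irrefl refl (∈N⁻ u∈N) })
      (λ {u} u∈ → ∈N⁺ (clique w u w∈K (x∈p-y⇒x∈p {p = K} u∈) (≢-sym (x∈p-y⇒x≢y {p = K} u∈))))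

    pivot⇒deg≡ : deg G w ≡ ω G ∸ 1
    pivot⇒deg≡ = begin
      ∣ N G w ∣      ≡⟨ cong ∣_∣ pivot⇒N≡ ⟩
      ∣ K ∖ w ∣      ≡⟨ cong (_∸ 1) (x∈p⇒∣p∣≡1+∣p-x∣ w∈K) ⟨
      ∣ K ∣ ∸ 1      ≡⟨ cong (_∸ 1) pivot⇒∣K∣≡ω ⟩
      ω G ∸ 1        ∎
      where open ≡-Reasoning

    pivot⇒swing : IsSwing G w
    pivot⇒swing = _ , _ , _ , _ , part , to-independent part w∈K w≁S , w∈K , x∈p∪q⁺ (inj₂ (x∈⁅x⁆ w))

  -- If w ∈ K has a neighbour z ∈ S, then z ∈ K′ is adjacent to all of K, and moving z into K makes w a pivot.
  swing⇒pivot : ∀ {w} → IsSwing G w → ∃₂ λ K S → Pivot K S w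
  swing⇒pivot {w} (K , S , K′ , S′ , part , part′ , w∈K , w∈S′)
    with Fin.any? (λ z → z ∈? S ×-dec w ~? z)
  ... | no ¬z = K , S , mkPivot part w∈K λ v v∈S w~v → ¬z (v , v∈S , w~v)
  ... | yes (z , z∈S , w~z) = _ , _ , mkPivot (to-clique part z∈S z~K) (x∈p∪q⁺ (inj₁ w∈K)) w≁S-z
    where
    module P = IsSPartition part
    module P′ = IsSPartition part′
    N⊆K′ : ∀ {v} → w ~ v → v ∈ K′
    N⊆K′ w~v = ∉S⇒∈K part′ λ v∈S′ → P′.independent _ _ w∈S′ v∈S′ w~v
    z~K : ∀ u → u ∈ K → z ~ u
    z~K u u∈K with w Fin.≟ u
    ... | yes refl = ~-sym w~z
    ... | no w≢u   = P′.clique z u (N⊆K′ w~z) (N⊆K′ (P.clique w u w∈K u∈K w≢u)) λ { refl → exclusive part u∈K z∈S }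
    -- A second neighbour of `w` in `S` would lie in the clique `K′` together with `z` and hence be
    -- adjacent to `z`, though both lie in `S`.
    w≁S-z : ∀ v → v ∈ S ∖ z → ¬ w ~ v
    w≁S-z v v∈S-z w~v = P.independent v z v∈S z∈S
      (P′.clique v z (N⊆K′ w~v) (N⊆K′ w~z) (x∈p-y⇒x≢y {p = S} v∈S-z))
      where v∈S = x∈p-y⇒x∈p {p = S} v∈S-z

  ∈W⇒deg≡ : ∀ {v} → v ∈ W G → deg G v ≡ ω G ∸ 1
  ∈W⇒deg≡ v∈W with _ , _ , pivot ← swing⇒pivot (∈⟪⟫⁻ (isSwing? G) v∈W) = pivot⇒deg≡ pivot

  -- A vertex outside `S*` is missing from the independent side of some s-partition, so it lies on
  -- the clique side there. Compared with the given partition, this makes it swing.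
  ∈S⇒∈S*⊎∈W : ∀ {K S} → IsSPartition G K S → ∀ {v} → v ∈ S → v ∈ S* G ⊎ v ∈ W G
  ∈S⇒∈S*⊎∈W part {v} v∈S with v ∈? S* G
  ... | yes v∈S* = inj₁ v∈S*
  ... | no v∉S*
    with S′ , S′∈ , v∉S′ ← x∉⋂⇒∃ (filter (λ S → anySubset? λ K → isSPartition? G K S) (subsets n)) v∉S*
    with K′ , part′ ← proj₂ (∈-filter⁻ (λ S → anySubset? λ K → isSPartition? G K S) {xs = subsets n} S′∈)
    = inj₂ (∈⟪⟫⁺ (isSwing? G) (_ , _ , _ , _ , part′ , part , ∉S⇒∈K part′ v∉S′ , v∈S))

  -- The swing vertices as seen from a fixed pivot.

  module _ {K S y} (pivot : Pivot K S y) where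
    open Pivot pivot renaming (w∈K to y∈K; w≁S to y≁S)
    open IsSPartition part

    ∣K-_∣ : ∀ {v} → v ∈ K → ∣ K ∖ v ∣ ≡ ω G ∸ 1
    ∣K- v∈K ∣ = trans (sym (cong (_∸ 1) (x∈p⇒∣p∣≡1+∣p-x∣ v∈K))) (cong (_∸ 1) (pivot⇒∣K∣≡ω pivot))

    -- The neighbourhood of `v` contains `K - v`, which already has `ω - 1` elements. By counting
    -- the two are equal, which leaves no neighbour in `S`.
    deg≡⇒pivot : ∀ {v} → deg G v ≡ ω G ∸ 1 → v ∈ K → Pivot K S v
    deg≡⇒pivot {v} deg≡ v∈K = mkPivot part v∈K λ u u∈S v~u →
      exclusive part (x∈p-y⇒x∈p {p = K} (N⊆K-v (∈N⁺ v~u))) u∈S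
      where
      N⊆K-v : N G v ⊆ K ∖ v
      N⊆K-v = p⊆q∧∣q∣≤∣p∣⇒q⊆p
        (λ u∈ → ∈N⁺ (clique v _ v∈K (x∈p-y⇒x∈p {p = K} u∈) (≢-sym (x∈p-y⇒x≢y {p = K} u∈))))
        (ℕ.≤-reflexive (trans deg≡ (sym ∣K- v∈K ∣)))

    -- A vertex of `S` has neighbours only in `K`, and `y` is not one of them. The inclusion in
    -- `K - y` is an equality by size.
    deg≡⇒N≡K-y : ∀ {v} → deg G v ≡ ω G ∸ 1 → v ∈ S → N G v ≡ K ∖ y
    deg≡⇒N≡K-y {v} deg≡ v∈S = ⊆-antisym N⊆K-y
      (p⊆q∧∣q∣≤∣p∣⇒q⊆p N⊆K-y (ℕ.≤-reflexive (trans ∣K- y∈K ∣ (sym deg≡))))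
      where
      N⊆K-y : N G v ⊆ K ∖ y
      N⊆K-y u∈N = x∈p∧x≢y⇒x∈p-y (∉S⇒∈K part λ u∈S → independent _ _ v∈S u∈S (∈N⁻ u∈N))
        λ { refl → y≁S v v∈S (~-sym (∈N⁻ u∈N)) }

    deg≡⇒∈W : ∀ {v} → deg G v ≡ ω G ∸ 1 → v ∈ W G
    deg≡⇒∈W {v} deg≡ with either part v
    ... | inj₁ v∈K = ∈⟪⟫⁺ (isSwing? G) (pivot⇒swing (deg≡⇒pivot deg≡ v∈K))
    -- First `y` moves to the independent side. Then `v` is adjacent to all that remains of the
    -- clique and can move there.
    ... | inj₂ v∈S = ∈⟪⟫⁺ (isSwing? G) (_ , _ , _ , _ , to-clique part′ v∈S∪y v~K-y , part , x∈p∪q⁺ (inj₂ (x∈⁅x⁆ v)) , v∈S)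
      where
      part′ : IsSPartition G (K ∖ y) (S ∪ ⁅ y ⁆)
      part′ = to-independent part y∈K y≁S
      v∈S∪y : v ∈ S ∪ ⁅ y ⁆
      v∈S∪y = x∈p∪q⁺ (inj₁ v∈S)
      v~K-y : ∀ u → u ∈ K ∖ y → v ~ u
      v~K-y u u∈ = ∈N⁻ (subst (u ∈_) (sym (deg≡⇒N≡K-y deg≡ v∈S)) u∈)

    y∈W : y ∈ W G
    y∈W = ∈⟪⟫⁺ (isSwing? G) (pivot⇒swing pivot)

    ∈W∩K⇒pivot : ∀ {v} → v ∈ W G → v ∈ K → Pivot K S v
    ∈W∩K⇒pivot v∈W = deg≡⇒pivot (∈W⇒deg≡ v∈W)

    ∈W∩S⇒N≡K-y : ∀ {v} → v ∈ W G → v ∈ S → N G v ≡ K ∖ y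
    ∈W∩S⇒N≡K-y v∈W = deg≡⇒N≡K-y (∈W⇒deg≡ v∈W)

    -- A swing vertex `x` in `S` is adjacent to all of `K - y`. Every swing vertex in `K` is a pivot
    -- and so not adjacent to `x`, hence it can only be `y`, whose neighbourhood is also `K - y`.
    W-shape : (W G ⊆ K) ⊎ (∀ {v} → v ∈ W G → N G v ≡ K ∖ y)
    W-shape with Fin.any? (λ x → x ∈? W G ×-dec x ∈? S)
    ... | no ¬x = inj₁ λ {v} v∈W → ∉S⇒∈K part λ v∈S → ¬x (v , v∈W , v∈S)
    ... | yes (x , x∈W , x∈S) = inj₂ N≡
      where
      N≡ : ∀ {v} → v ∈ W G → N G v ≡ K ∖ y
      N≡ {v} v∈W with either part v | v Fin.≟ y
      ... | inj₂ v∈S | _        = ∈W∩S⇒N≡K-y v∈W v∈S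
      ... | inj₁ _   | yes refl = pivot⇒N≡ pivot
      ... | inj₁ v∈K | no v≢y   = contradiction
        (~-sym (∈N⁻ (subst (v ∈_) (sym (∈W∩S⇒N≡K-y x∈W x∈S)) (x∈p∧x≢y⇒x∈p-y v∈K v≢y))))
        (Pivot.w≁S (∈W∩K⇒pivot v∈W v∈K) x x∈S)

    W-clique⊎independent : IsClique G (W G) ⊎ IsIndependent G (W G)
    W-clique⊎independent with W-shape
    ... | inj₁ W⊆K = inj₁ λ u v u∈W v∈W → clique u v (W⊆K u∈W) (W⊆K v∈W)
    -- Adjacent vertices with equal neighbourhoods would be adjacent to themselves.
    ... | inj₂ N≡  = inj₂ λ u v u∈W v∈W u~v →
      ~-irrefl refl (∈N⁻ (subst (v ∈_) (trans (N≡ u∈W) (sym (N≡ v∈W))) (∈N⁺ u~v)))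

    twins : ∀ {u v} → u ∈ W G → v ∈ W G → Twins G u v
    twins {u} {v} u∈W v∈W with W-shape
    ... | inj₁ W⊆K = begin
      N G u ∖ v    ≡⟨ cong (_∖ v) (pivot⇒N≡ (∈W∩K⇒pivot u∈W (W⊆K u∈W))) ⟩
      K ∖ u ∖ v    ≡⟨ p─x─y≡p─y─x K u v ⟩
      K ∖ v ∖ u    ≡⟨ cong (_∖ u) (pivot⇒N≡ (∈W∩K⇒pivot v∈W (W⊆K v∈W))) ⟨
      N G v ∖ u    ∎
      where open ≡-Reasoning
    ... | inj₂ N≡ = begin
      N G u ∖ v    ≡⟨ cong (_∖ v) Nu≡Nv ⟩
      N G v ∖ v    ≡⟨ x∉p⇒p-x≡p (~-irrefl refl ∘ ∈N⁻) ⟩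
      N G v        ≡⟨ Nu≡Nv ⟨
      N G u        ≡⟨ x∉p⇒p-x≡p (~-irrefl refl ∘ ∈N⁻) ⟨
      N G u ∖ u    ≡⟨ cong (_∖ u) Nu≡Nv ⟩
      N G v ∖ u    ∎
      where
      open ≡-Reasoning
      Nu≡Nv = trans (N≡ u∈W) (sym (N≡ v∈W))

-- Sequences tending to 0

Null : (ℕ → ℚ) → Set
Null f = ∀ ε → 0ℚ <ℚ ε → ∃ λ N → ∀ i → N ℕ.≤ i → ∣ f i ∣ℚ <ℚ ε

Null-cong : ∀ {f g} → (∀ i → f i ≡ g i) → Null f → Null g
Null-cong f≗g f→0 ε 0<ε with N , f<ε ← f→0 ε 0<ε =
  N , λ i N≤i → subst (λ z → ∣ z ∣ℚ <ℚ ε) (f≗g i) (f<ε i N≤i)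

p-0≡p : ∀ p → p - 0ℚ ≡ p
p-0≡p = ℚ.+-identityʳ

≃0⇒Null : ∀ {x} → x ≃ 0ℝ → Null (approx x)
≃0⇒Null = Null-cong (λ _ → p-0≡p _)

Null⇒≃0 : ∀ {x} → Null (approx x) → x ≃ 0ℝ
Null⇒≃0 = Null-cong (λ _ → sym (p-0≡p _))

Null-0 : Null (λ _ → 0ℚ)
Null-0 ε 0<ε = 0 , λ _ _ → 0<ε

0<½*p : ∀ {p} → 0ℚ <ℚ p → 0ℚ <ℚ ½ * p
0<½*p {p} 0<p = subst (_<ℚ ½ * p) (ℚ.*-zeroʳ ½) (ℚ.*-monoʳ-<-pos ½ 0<p)

½*p+½*p≡p : ∀ p → ½ * p + ½ * p ≡ p
½*p+½*p≡p p = trans (sym (ℚ.*-distribʳ-+ p ½ ½)) (ℚ.*-identityˡ p)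

Null-+ : ∀ {f g} → Null f → Null g → Null (λ i → f i + g i)
Null-+ {f} {g} f→0 g→0 ε 0<ε
  with M , f<½ε ← f→0 (½ * ε) (0<½*p 0<ε) | N , g<½ε ← g→0 (½ * ε) (0<½*p 0<ε)
  = M ℕ.⊔ N , λ i M⊔N≤i → begin-strict
    ∣ f i + g i ∣ℚ      ≤⟨ ℚ.∣p+q∣≤∣p∣+∣q∣ (f i) (g i) ⟩
    ∣ f i ∣ℚ + ∣ g i ∣ℚ  <⟨ ℚ.+-mono-< (f<½ε i (ℕ.m⊔n≤o⇒m≤o M N M⊔N≤i)) (g<½ε i (ℕ.m⊔n≤o⇒n≤o M N M⊔N≤i)) ⟩
    ½ * ε + ½ * ε      ≡⟨ ½*p+½*p≡p ε ⟩
    ε                  ∎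
  where open ℚ.≤-Reasoning

Null-neg : ∀ {f} → Null f → Null (λ i → - f i)
Null-neg {f} f→0 ε 0<ε with N , f<ε ← f→0 ε 0<ε =
  N , λ i N≤i → subst (_<ℚ ε) (sym (ℚ.∣-p∣≡∣p∣ (f i))) (f<ε i N≤i)

Null-∑ : ∀ {n} {f : ℕ → Vector ℚ n} → (∀ k → Null (λ i → f i k)) → Null (λ i → ∑ (f i))
Null-∑ {zero}  f→0 = Null-0
Null-∑ {suc n} f→0 = Null-+ (f→0 zero) (Null-∑ (f→0 ∘ suc))

-- The Cauchy condition at 1 keeps all later terms within 1 of the term at `N`; the summand 1 also
-- makes the bound positive, so that it can be divided by.
bounded : ∀ (r : ℝ) → ∃ λ M → 0ℚ <ℚ M × ∃ λ N → ∀ i → N ℕ.≤ i → ∣ approx r i ∣ℚ ≤ℚ M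
bounded r with N , r-cauchy ← cauchy r 1ℚ (ℚ.positive⁻¹ 1ℚ) =
  1ℚ + ∣ rN ∣ℚ , ℚ.+-mono-<-≤ (ℚ.positive⁻¹ 1ℚ) (ℚ.0≤∣p∣ rN) , N , λ i N≤i → begin
    ∣ approx r i ∣ℚ              ≡⟨ cong ∣_∣ℚ (p≡[p-q]+q (approx r i) rN) ⟩
    ∣ approx r i - rN + rN ∣ℚ    ≤⟨ ℚ.∣p+q∣≤∣p∣+∣q∣ (approx r i - rN) rN ⟩
    ∣ approx r i - rN ∣ℚ + ∣ rN ∣ℚ ≤⟨ ℚ.+-monoˡ-≤ ∣ rN ∣ℚ (ℚ.<⇒≤ (r-cauchy i N N≤i ℕ.≤-refl)) ⟩
    1ℚ + ∣ rN ∣ℚ                 ∎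
  where
  open ℚ.≤-Reasoning
  rN = approx r N
  p≡[p-q]+q : ∀ p q → p ≡ p - q + q
  p≡[p-q]+q = solve 2 (λ p q → p := p :- q :+ q) refl
    where open +-*-Solver

divide : ∀ {p q} → 0ℚ <ℚ p → 0ℚ <ℚ q → ∃ λ r → 0ℚ <ℚ r × p * r ≡ q
divide {p} {q} 0<p 0<q =
  1/p * q , ℚ.positive⁻¹ _ {{ℚ.pos*pos⇒pos 1/p {{ℚ.1/pos⇒pos p}} q}} , (begin
    p * (1/p * q)  ≡⟨ ℚ.*-assoc p 1/p q ⟨
    p * 1/p * q    ≡⟨ cong (_* q) (ℚ.*-inverseʳ p) ⟩
    1ℚ * q         ≡⟨ ℚ.*-identityˡ q ⟩
    q              ∎)
  where
  open ≡-Reasoning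
  instance
    _ = positive 0<p
    _ = positive 0<q
    _ = ℚ.pos⇒nonZero p
  1/p = 1/ p

∣p*q∣<M*δ : ∀ {p q M δ} → 0ℚ <ℚ M → ∣ p ∣ℚ ≤ℚ M → ∣ q ∣ℚ <ℚ δ → ∣ p * q ∣ℚ <ℚ M * δ
∣p*q∣<M*δ {p} {q} {M} {δ} 0<M p≤M q<δ = begin-strict
  ∣ p * q ∣ℚ      ≡⟨ ℚ.∣p*q∣≡∣p∣*∣q∣ p q ⟩
  ∣ p ∣ℚ * ∣ q ∣ℚ  ≤⟨ ℚ.*-monoʳ-≤-nonNeg ∣ q ∣ℚ {{ℚ.∣-∣-nonNeg q}} p≤M ⟩
  M * ∣ q ∣ℚ      <⟨ ℚ.*-monoʳ-<-pos M {{positive 0<M}} q<δ ⟩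
  M * δ          ∎
  where open ℚ.≤-Reasoning

-- The factor `r` need not tend to 0: eventually it is bounded by some `M`, and `f` is taken below a
-- `δ` with `M * δ ≡ ε`.
Null-* : ∀ (r : ℝ) {f} → Null f → Null (λ i → approx r i * f i)
Null-* r {f} f→0 ε 0<ε =
  let M , 0<M , B , r≤M = bounded r
      δ , 0<δ , Mδ≡ε    = divide 0<M 0<ε
      N , f<δ           = f→0 δ 0<δ
  in B ℕ.⊔ N , λ i B⊔N≤i → subst (∣ approx r i * f i ∣ℚ <ℚ_) Mδ≡ε
       (∣p*q∣<M*δ 0<M (r≤M i (ℕ.m⊔n≤o⇒m≤o B N B⊔N≤i)) (f<δ i (ℕ.m⊔n≤o⇒n≤o B N B⊔N≤i)))

p*p≡∣p∣*∣p∣ : ∀ p → p * p ≡ ∣ p ∣ℚ * ∣ p ∣ℚ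
p*p≡∣p∣*∣p∣ p with ℚ.∣p∣≡p∨∣p∣≡-p p
... | inj₁ eq = sym (cong₂ _*_ eq eq)
... | inj₂ eq = trans (neg-sq p) (sym (cong₂ _*_ eq eq))
  where
  neg-sq : ∀ p → p * p ≡ - p * - p
  neg-sq = solve 1 (λ p → p :* p := :- p :* :- p) refl
    where open +-*-Solver

0≤p*p : ∀ p → 0ℚ ≤ℚ p * p
0≤p*p p = subst (0ℚ ≤ℚ_) (sym (p*p≡∣p∣*∣p∣ p))
  (ℚ.nonNegative⁻¹ (∣ p ∣ℚ * ∣ p ∣ℚ) {{ℚ.nonNeg*nonNeg⇒nonNeg (∣ p ∣ℚ) {{ℚ.∣-∣-nonNeg p}} (∣ p ∣ℚ) {{ℚ.∣-∣-nonNeg p}}}})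

p≤∣p∣ : ∀ p → p ≤ℚ ∣ p ∣ℚ
p≤∣p∣ p with ℚ.≤-total 0ℚ p
... | inj₁ 0≤p = ℚ.≤-reflexive (sym (ℚ.0≤p⇒∣p∣≡p 0≤p))
... | inj₂ p≤0 = ℚ.≤-trans p≤0 (ℚ.0≤∣p∣ p)

-- Squares are compared, so that no square root is taken: once `g` is below `ε * ε`, having
-- `ε ≤ ∣ f i ∣` would give `ε * ε < ε * ε`.
Null-sqrt : ∀ {f g} → (∀ i → f i * f i ≤ℚ g i) → Null g → Null f
Null-sqrt {f} {g} f²≤g g→0 ε 0<ε
  with N , g<ε² ← g→0 (ε * ε) (ℚ.positive⁻¹ _ {{ℚ.pos*pos⇒pos ε {{positive 0<ε}} ε {{positive 0<ε}}}})
  = N , λ i N≤i → ℚ.≰⇒> λ ε≤∣f∣ → ℚ.<-irrefl refl (begin-strict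
    ε * ε              ≤⟨ ℚ.*-monoˡ-≤-nonNeg ε {{0≤ε}} ε≤∣f∣ ⟩
    ε * ∣ f i ∣ℚ         ≤⟨ ℚ.*-monoʳ-≤-nonNeg ∣ f i ∣ℚ {{ℚ.∣-∣-nonNeg (f i)}} ε≤∣f∣ ⟩
    ∣ f i ∣ℚ * ∣ f i ∣ℚ   ≡⟨ p*p≡∣p∣*∣p∣ (f i) ⟨
    f i * f i          ≤⟨ f²≤g i ⟩
    g i                ≤⟨ p≤∣p∣ (g i) ⟩
    ∣ g i ∣ℚ             <⟨ g<ε² i N≤i ⟩
    ε * ε              ∎)
  where
  open ℚ.≤-Reasoning
  0≤ε : NonNegative ε
  0≤ε = ℚ.pos⇒nonNeg ε {{positive 0<ε}}

-- Sums with indicator coefficients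

𝟙 : ∀ {P : Set} → Dec P → ℚ
𝟙 P? = if does P? then 1ℚ else 0ℚ

∑-mono : ∀ {n} {f g : Vector ℚ n} → (∀ k → f k ≤ℚ g k) → ∑ f ≤ℚ ∑ g
∑-mono {zero}  f≤g = ℚ.≤-refl
∑-mono {suc n} f≤g = ℚ.+-mono-≤ (f≤g zero) (∑-mono (f≤g ∘ suc))

∑-neg : ∀ {n} (f : Vector ℚ n) → ∑ (λ k → - f k) ≡ - ∑ f
∑-neg {zero}  f = refl
∑-neg {suc n} f = trans (cong (- f zero +_) (∑-neg (f ∘ suc))) (sym (ℚ.neg-distrib-+ (f zero) _))

∑-distrib-- : ∀ {n} (f g : Vector ℚ n) → ∑ (λ k → f k - g k) ≡ ∑ f - ∑ g
∑-distrib-- f g = trans (∑-distrib-+ f (-_ ∘ g)) (cong (∑ f +_) (∑-neg g))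

∑-𝟙 : ∀ {n} (u : Fin n) (f : Vector ℚ n) → ∑ (λ v → 𝟙 (u Fin.≟ v) * f v) ≡ f u
∑-𝟙 {suc n} zero f = begin
  1ℚ * f zero + ∑ (λ v → 0ℚ * f (suc v))  ≡⟨ cong₂ _+_ (ℚ.*-identityˡ (f zero)) (sum-cong-≗ (λ v → ℚ.*-zeroˡ (f (suc v)))) ⟩
  f zero + ∑ {n} (λ _ → 0ℚ)                   ≡⟨ cong (f zero +_) (sum-replicate-zero n) ⟩
  f zero + 0ℚ                             ≡⟨ ℚ.+-identityʳ _ ⟩
  f zero                                  ∎
  where open ≡-Reasoning
∑-𝟙 (suc u) f = trans (cong₂ _+_ (ℚ.*-zeroˡ (f zero)) (∑-𝟙 u (f ∘ suc))) (ℚ.+-identityˡ _)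

approx-sum : ∀ {n} (x : Vector ℝ n) i → approx (sum x) i ≡ ∑ (λ k → approx (x k) i)
approx-sum {zero}  x i = refl
approx-sum {suc n} x i = cong (approx (x zero) i +_) (approx-sum (x ∘ suc) i)

const : ℚ → ℝ
const q = mkℝ (λ _ → q) λ ε 0<ε → 0 , λ _ _ _ _ →
  subst (λ z → ∣ z ∣ℚ <ℚ ε) (sym (ℚ.+-inverseʳ q)) 0<ε

-- The quadratic form of a matrix with signed rows.

_⊛_ : ∀ {n} → (Fin n → Fin n → ℚ) → Vector ℚ n → Vector ℚ n
(A ⊛ x) u = ∑ (λ v → A u v * x v)

-- 1 on K and -1 off K, when κ is the indicator of K.
σ : ∀ {n} → Vector ℚ n → Vector ℚ n
σ κ u = κ u - (1ℚ - κ u)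

module _ {n} (A : Fin n → Fin n → ℚ) (κ : Vector ℚ n) where

  -- The bracket in the second hypothesis is antisymmetric in u and v, so its contribution cancels.
  signed-form : (∀ u v → A u v ≡ A v u) →
    (∀ u v → σ κ u * A u v ≡
      κ u * κ v - 𝟙 (u Fin.≟ v) * κ u + (κ u * (1ℚ - κ v) * A u v - κ v * (1ℚ - κ u) * A u v)) →
    ∀ x → let s = ∑ (λ u → κ u * x u) in
    ∑ (λ u → σ κ u * (x u * (A ⊛ x) u)) ≡ s * s - ∑ (λ u → κ u * (x u * x u))
  signed-form A-sym entry x = begin
    ∑ (λ u → σ κ u * (x u * (A ⊛ x) u))
      ≡⟨ sum-cong-≗ row ⟩
    ∑ (λ u → κ u * x u * s - κ u * (x u * x u) + (∑ (p u) - ∑ (λ v → p v u)))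
      ≡⟨ ∑-distrib-+ (λ u → κ u * x u * s - κ u * (x u * x u)) (λ u → ∑ (p u) - ∑ (λ v → p v u)) ⟩
    ∑ (λ u → κ u * x u * s - κ u * (x u * x u)) + ∑ (λ u → ∑ (p u) - ∑ (λ v → p v u))
      ≡⟨ cong₂ _+_ (∑-distrib-- (λ u → κ u * x u * s) (λ u → κ u * (x u * x u)))
                   (∑-distrib-- (λ u → ∑ (p u)) (λ u → ∑ (λ v → p v u))) ⟩
    (∑ (λ u → κ u * x u * s) - t) + (∑ (λ u → ∑ (p u)) - ∑ (λ u → ∑ (λ v → p v u)))
      ≡⟨ cong₂ (λ a b → (a - t) + (∑ (λ u → ∑ (p u)) - b))
               (sym (*-distribʳ-sum s (λ u → κ u * x u))) (∑-comm (λ u v → p v u)) ⟩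
    (s * s - t) + (∑ (λ u → ∑ (p u)) - ∑ (λ u → ∑ (p u)))
      ≡⟨ cong ((s * s - t) +_) (ℚ.+-inverseʳ (∑ (λ u → ∑ (p u)))) ⟩
    (s * s - t) + 0ℚ
      ≡⟨ ℚ.+-identityʳ _ ⟩
    s * s - t ∎
    where
    open ≡-Reasoning
    s = ∑ (λ u → κ u * x u)
    t = ∑ (λ u → κ u * (x u * x u))
    -- The contribution of the pairs with `u` in `K` and `v` outside. Its double sum is the same as
    -- that of `p v u`, by exchanging the order of summation.
    p : Fin n → Fin n → ℚ
    p u v = κ u * (1ℚ - κ v) * A u v * (x u * x v)

    -- The last product is written `z * y` so that, once `A u v` is replaced by `A v u`, the term is
    -- literally `p v u`.
    expand : ∀ k l d a y z →
      (k * l - d * k + (k * (1ℚ - l) * a - l * (1ℚ - k) * a)) * (y * z) ≡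
      k * y * (l * z) - d * (k * (y * z)) + (k * (1ℚ - l) * a * (y * z) - l * (1ℚ - k) * a * (z * y))
    expand = solve 6 (λ k l d a y z →
      (k :* l :- d :* k :+ (k :* (con 1ℚ :- l) :* a :- l :* (con 1ℚ :- k) :* a)) :* (y :* z) :=
      k :* y :* (l :* z) :- d :* (k :* (y :* z)) :+
        (k :* (con 1ℚ :- l) :* a :* (y :* z) :- l :* (con 1ℚ :- k) :* a :* (z :* y))) refl
      where open +-*-Solver

    regroup : ∀ c y a z → c * (y * (a * z)) ≡ (c * a) * (y * z)
    regroup = solve 4 (λ c y a z → c :* (y :* (a :* z)) := (c :* a) :* (y :* z)) refl
      where open +-*-Solver

    cell : ∀ u v → σ κ u * (x u * (A u v * x v)) ≡
      κ u * x u * (κ v * x v) - 𝟙 (u Fin.≟ v) * (κ u * (x u * x v)) + (p u v - p v u)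
    cell u v = begin
      σ κ u * (x u * (A u v * x v))   ≡⟨ regroup (σ κ u) (x u) (A u v) (x v) ⟩
      (σ κ u * A u v) * (x u * x v)   ≡⟨ cong (_* (x u * x v)) (entry u v) ⟩
      _                               ≡⟨ expand (κ u) (κ v) (𝟙 (u Fin.≟ v)) (A u v) (x u) (x v) ⟩
      _                               ≡⟨ cong (λ a → κ u * x u * (κ v * x v) - 𝟙 (u Fin.≟ v) * (κ u * (x u * x v))
                                          + (p u v - κ v * (1ℚ - κ u) * a * (x v * x u))) (A-sym u v) ⟩
      _                               ∎

    row : ∀ u → σ κ u * (x u * (A ⊛ x) u) ≡
      κ u * x u * s - κ u * (x u * x u) + (∑ (p u) - ∑ (λ v → p v u))
    row u = begin
      σ κ u * (x u * (A ⊛ x) u)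
        ≡⟨ cong (σ κ u *_) (*-distribˡ-sum (x u) (λ v → A u v * x v)) ⟩
      σ κ u * ∑ (λ v → x u * (A u v * x v))
        ≡⟨ *-distribˡ-sum (σ κ u) (λ v → x u * (A u v * x v)) ⟩
      ∑ (λ v → σ κ u * (x u * (A u v * x v)))
        ≡⟨ sum-cong-≗ (cell u) ⟩
      ∑ (λ v → κ u * x u * (κ v * x v) - 𝟙 (u Fin.≟ v) * (κ u * (x u * x v)) + (p u v - p v u))
        ≡⟨ ∑-distrib-+ (λ v → κ u * x u * (κ v * x v) - 𝟙 (u Fin.≟ v) * (κ u * (x u * x v))) (λ v → p u v - p v u) ⟩
      _ ≡⟨ cong₂ _+_ (∑-distrib-- (λ v → κ u * x u * (κ v * x v)) (λ v → 𝟙 (u Fin.≟ v) * (κ u * (x u * x v))))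
                     (∑-distrib-- (p u) (λ v → p v u)) ⟩
      _ ≡⟨ cong₂ (λ a b → a - b + (∑ (p u) - ∑ (λ v → p v u)))
                 (sym (*-distribˡ-sum (κ u * x u) (λ v → κ v * x v))) (∑-𝟙 u (λ v → κ u * (x u * x v))) ⟩
      _ ∎

-- Null vectors of the adjacency matrix.

module _ {n} (G : Graph n) where
  open Graph G

  𝔸 : Fin n → Fin n → ℚ
  𝔸 u v = 𝟙 (u ~? v)

  𝔸-sym : ∀ u v → 𝔸 u v ≡ 𝔸 v u
  𝔸-sym u v with u ~? v | v ~? u
  ... | yes _   | yes _   = refl
  ... | no _    | no _    = refl
  ... | yes u~v | no v≁u  = contradiction (~-sym u~v) v≁u
  ... | no u≁v  | yes v~u = contradiction (~-sym v~u) u≁v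

  approx-adjacency : ∀ (x : Vector ℝ n) u i →
    approx (sum (λ v → adjacency G u v · x v)) i ≡ (𝔸 ⊛ λ v → approx (x v) i) u
  approx-adjacency x u i = trans (approx-sum (λ v → adjacency G u v · x v) i) (sum-cong-≗ entry)
    where
    entry : ∀ v → approx (adjacency G u v · x v) i ≡ 𝔸 u v * approx (x v) i
    entry v with does (u ~? v)
    ... | true  = trans (ℚ.+-identityʳ (approx (x v) i)) (sym (ℚ.*-identityˡ (approx (x v) i)))
    ... | false = sym (ℚ.*-zeroˡ (approx (x v) i))

  module _ {K S y} (pivot : Pivot G K S y) where
    open Pivot pivot renaming (w∈K to y∈K; w≁S to y≁S)
    open IsSPartition part

    κ : Vector ℚ n
    κ u = 𝟙 (u ∈? K)

    -- Inside `K` the matrix is all ones off the diagonal, and inside `S` it is 0. Entries between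
    -- `K` and `S` are left to the bracket, with opposite signs for the two orders.
    signed-entry : ∀ u v → σ κ u * 𝔸 u v ≡
      κ u * κ v - 𝟙 (u Fin.≟ v) * κ u + (κ u * (1ℚ - κ v) * 𝔸 u v - κ v * (1ℚ - κ u) * 𝔸 u v)
    signed-entry u v with u Fin.≟ v
    ... | yes refl with u ∈? K | u ~? u
    ...   | _        | yes u~u = contradiction u~u (~-irrefl refl)
    ...   | yes _    | no _ = refl
    ...   | no _     | no _ = refl
    signed-entry u v | no u≢v with u ∈? K | v ∈? K | u ~? v
    ... | yes u∈K | yes v∈K | no u≁v  = contradiction (clique u v u∈K v∈K u≢v) u≁v
    ... | no u∉K  | no v∉K  | yes u~v = contradiction u~v (independent u v (∉K⇒∈S G part u∉K) (∉K⇒∈S G part v∉K))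
    ... | yes _   | yes _   | yes _   = refl
    ... | yes _   | no _    | yes _   = refl
    ... | yes _   | no _    | no _    = refl
    ... | no _    | yes _   | yes _   = refl
    ... | no _    | yes _   | no _    = refl
    ... | no _    | no _    | no _    = refl

    -- The pivot is adjacent to exactly the rest of `K`.
    free-row : ∀ v → 𝔸 y v ≡ κ v - 𝟙 (y Fin.≟ v)
    free-row v with y Fin.≟ v
    ... | yes refl with y ∈? K | y ~? y
    ...   | _      | yes y~y = contradiction y~y (~-irrefl refl)
    ...   | yes _  | no _    = refl
    ...   | no y∉K | no _    = contradiction y∈K y∉K
    free-row v | no y≢v with v ∈? K | y ~? v
    ... | yes v∈K | no y≁v  = contradiction (clique y v y∈K v∈K y≢v) y≁v
    ... | no v∉K  | yes y~v = contradiction y~v (y≁S v (∉K⇒∈S G part v∉K))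
    ... | yes _   | yes _   = refl
    ... | no _    | no _    = refl

    -- For a null vector this is `s = x y`; the row term is kept because rational approximations
    -- satisfy the equation only up to an error.
    free-row-∑ : ∀ x → ∑ (λ u → κ u * x u) ≡ x y + (𝔸 ⊛ x) y
    free-row-∑ x = begin
      s                                                   ≡⟨ p≡q+[p-q] s (x y) ⟩
      x y + (s - x y)                                     ≡⟨ cong (λ z → x y + (s - z)) (∑-𝟙 y x) ⟨
      x y + (s - ∑ (λ u → 𝟙 (y Fin.≟ u) * x u))           ≡⟨ cong (x y +_) (∑-distrib-- (λ u → κ u * x u) (λ u → 𝟙 (y Fin.≟ u) * x u)) ⟨
      x y + ∑ (λ u → κ u * x u - 𝟙 (y Fin.≟ u) * x u)     ≡⟨ cong (x y +_) (sum-cong-≗ λ u →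
        trans (distribʳ-- (κ u) (𝟙 (y Fin.≟ u)) (x u)) (cong (_* x u) (sym (free-row u)))) ⟩
      x y + (𝔸 ⊛ x) y ∎
      where
      open ≡-Reasoning
      s = ∑ (λ u → κ u * x u)
      open +-*-Solver
      p≡q+[p-q] : ∀ p q → p ≡ q + (p - q)
      p≡q+[p-q] = solve 2 (λ p q → p := q :+ (p :- q)) refl
      distribʳ-- : ∀ p q r → p * r - q * r ≡ (p - q) * r
      distribʳ-- = solve 3 (λ p q r → p :* r :- q :* r := (p :- q) :* r) refl

    -- Equal to the sum of squares over `K` minus the square of `x y`, but written so that every
    -- summand has a factor `𝔸 ⊛ x`, which tends to 0 along the approximations of a null vector.
    residual : Vector ℚ n → ℚ
    residual x = (x y + x y + (𝔸 ⊛ x) y) * (𝔸 ⊛ x) y - ∑ (λ u → σ κ u * (x u * (𝔸 ⊛ x) u))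

    -- After the square at `y` is removed from the sum over `K`, the square at `v` remains since
    -- `v ≢ y`, and the other squares are nonnegative.
    square≤residual : ∀ {v} → v ∈ K → v ≢ y → ∀ x → x v * x v ≤ℚ residual x
    square≤residual {v} v∈K v≢y x = begin
      x v * x v
        ≡⟨ p≡q+p-q (x v * x v) (x y * x y) ⟩
      x y * x y + x v * x v - x y * x y
        ≡⟨ cong (λ z → z - x y * x y) (cong₂ _+_ (∑-𝟙 y (λ u → x u * x u)) (∑-𝟙 v (λ u → x u * x u))) ⟨
      ∑ (λ u → 𝟙 (y Fin.≟ u) * (x u * x u)) + ∑ (λ u → 𝟙 (v Fin.≟ u) * (x u * x u)) - x y * x y
        ≡⟨ cong (λ z → z - x y * x y) (∑-distrib-+ (λ u → 𝟙 (y Fin.≟ u) * (x u * x u)) (λ u → 𝟙 (v Fin.≟ u) * (x u * x u))) ⟨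
      ∑ (λ u → 𝟙 (y Fin.≟ u) * (x u * x u) + 𝟙 (v Fin.≟ u) * (x u * x u)) - x y * x y
        -- Comparison of coefficients: the indicators of the distinct members `y` and `v` of `K` add
        -- up to at most `κ`.
        ≤⟨ ℚ.+-monoˡ-≤ (- (x y * x y)) (∑-mono term) ⟩
      t - x y * x y
        ≡⟨ complete (x y) e t ⟩
      -- Here `x y + e` is the sum `s` over `K`, which brings in the signed form `s * s - t`.
      (x y + x y + e) * e - ((x y + e) * (x y + e) - t)
        ≡⟨ cong (λ s → (x y + x y + e) * e - (s * s - t)) (free-row-∑ x) ⟨
      (x y + x y + e) * e - (s * s - t)
        ≡⟨ cong (λ z → (x y + x y + e) * e - z) (signed-form 𝔸 κ 𝔸-sym signed-entry x) ⟨
      residual x ∎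
      where
      open ℚ.≤-Reasoning
      e = (𝔸 ⊛ x) y
      s = ∑ (λ u → κ u * x u)
      t = ∑ (λ u → κ u * (x u * x u))
      open +-*-Solver
      p≡q+p-q : ∀ p q → p ≡ q + p - q
      p≡q+p-q = solve 2 (λ p q → p := q :+ p :- q) refl
      complete : ∀ p e t → t - p * p ≡ (p + p + e) * e - ((p + e) * (p + e) - t)
      complete = solve 3 (λ p e t → t :- p :* p := (p :+ p :+ e) :* e :- ((p :+ e) :* (p :+ e) :- t)) refl
      term : ∀ u → 𝟙 (y Fin.≟ u) * (x u * x u) + 𝟙 (v Fin.≟ u) * (x u * x u) ≤ℚ κ u * (x u * x u)
      term u = begin
        𝟙 (y Fin.≟ u) * (x u * x u) + 𝟙 (v Fin.≟ u) * (x u * x u) ≡⟨ ℚ.*-distribʳ-+ (x u * x u) (𝟙 (y Fin.≟ u)) (𝟙 (v Fin.≟ u)) ⟨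
        (𝟙 (y Fin.≟ u) + 𝟙 (v Fin.≟ u)) * (x u * x u) ≤⟨ ℚ.*-monoʳ-≤-nonNeg (x u * x u) {{nonNegative (0≤p*p (x u))}} coefficient ⟩
        κ u * (x u * x u) ∎
        where
        coefficient : 𝟙 (y Fin.≟ u) + 𝟙 (v Fin.≟ u) ≤ℚ κ u
        coefficient with y Fin.≟ u | v Fin.≟ u | u ∈? K
        ... | yes y≡u  | yes v≡u  | _      = contradiction (trans v≡u (sym y≡u)) v≢y
        ... | yes refl | no _     | no y∉K = contradiction y∈K y∉K
        ... | no _     | yes refl | no v∉K = contradiction v∈K v∉K
        ... | yes _    | no _     | yes _  = ℚ.≤-refl
        ... | no _     | yes _    | yes _  = ℚ.≤-refl
        ... | no _     | no _     | yes _  = ℚ.<⇒≤ (ℚ.positive⁻¹ 1ℚ)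
        ... | no _     | no _     | no _   = ℚ.≤-refl

    null-on-clique : ∀ {x} → IsNull G x → ∀ {v} → v ∈ K → v ≢ y → x v ≃ 0ℝ
    null-on-clique {x} x-null {v} v∈K v≢y = Null⇒≃0 {x v} (Null-sqrt
      (λ i → square≤residual v∈K v≢y (λ u → approx (x u) i))
      (Null-+ (Null-cong (λ i → cong (λ e → (approx (x y) i + approx (x y) i + e) * (𝔸 ⊛ _) y) (approx-adjacency x y i))
                         -- `Null-*` takes a real as its first factor, so the bracket of `residual`
                         -- is assembled as a real number, and its row is then rewritten through
                         -- `approx-adjacency`.
                         (Null-* (x y +ℝ x y +ℝ sum (λ u → adjacency G y u · x u)) (null-row y)))
              (Null-neg (Null-∑ λ u → Null-* (const (σ κ u)) (Null-* (x u) (null-row u))))))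
      where
      null-row : ∀ u → Null (λ i → (𝔸 ⊛ λ v → approx (x v) i) u)
      null-row u = Null-cong (approx-adjacency x u) (≃0⇒Null {sum (λ v → adjacency G u v · x v)} (x-null u))

  𝔸-cong-N : ∀ {w w′} → N G w ≡ N G w′ → ∀ u → 𝔸 u w ≡ 𝔸 u w′
  𝔸-cong-N {w} {w′} Nw≡Nw′ u = begin
    𝔸 u w   ≡⟨ 𝔸-sym u w ⟩
    𝔸 w u   ≡⟨ cong (if_then 1ℚ else 0ℚ) same ⟩
    𝔸 w′ u  ≡⟨ 𝔸-sym w′ u ⟩
    𝔸 u w′  ∎
    where
    open ≡-Reasoning
    same : does (w ~? u) ≡ does (w′ ~? u)
    same = trans (sym (lookup∘tabulate _ u)) (trans (cong (λ p → lookup p u) Nw≡Nw′) (lookup∘tabulate _ u))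

  -- By symmetry the columns of `w` and `w′` coincide, so the difference of the two unit vectors is
  -- null, and its entry at `w` is 1.
  equal-neighbourhoods⇒supp : ∀ {w w′} → w ≢ w′ → N G w ≡ N G w′ → Supp G w
  equal-neighbourhoods⇒supp {w} {w′} w≢w′ Nw≡Nw′ = x , x-null , λ x≃0 →
    let M , x<1 = x≃0 1ℚ (ℚ.positive⁻¹ 1ℚ) in
    ℚ.<-irrefl refl (subst (λ z → ∣ z - 0ℚ ∣ℚ <ℚ 1ℚ) xw≡1 (x<1 M ℕ.≤-refl))
    where
    open ≡-Reasoning
    q : Vector ℚ n
    q v = 𝟙 (w Fin.≟ v) - 𝟙 (w′ Fin.≟ v)
    x : Vector ℝ n
    x v = const (q v)
    xw≡1 : q w ≡ 1ℚ
    xw≡1 = cong₂ (λ a b → (if a then 1ℚ else 0ℚ) - (if b then 1ℚ else 0ℚ))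
      (dec-true (w Fin.≟ w) refl) (dec-false (w′ Fin.≟ w) (≢-sym w≢w′))
    distrib : ∀ a b c → a * (b - c) ≡ b * a - c * a
    distrib = solve 3 (λ a b c → a :* (b :- c) := b :* a :- c :* a) refl
      where open +-*-Solver
    row≡0 : ∀ u → 0ℚ ≡ (𝔸 ⊛ q) u
    row≡0 u = begin
      0ℚ                ≡⟨ ℚ.+-inverseʳ (𝔸 u w) ⟨
      𝔸 u w - 𝔸 u w     ≡⟨ cong (λ a → 𝔸 u w - a) (𝔸-cong-N Nw≡Nw′ u) ⟩
      𝔸 u w - 𝔸 u w′    ≡⟨ cong₂ _-_ (∑-𝟙 w (𝔸 u)) (∑-𝟙 w′ (𝔸 u)) ⟨
      _                 ≡⟨ ∑-distrib-- (λ v → 𝟙 (w Fin.≟ v) * 𝔸 u v) (λ v → 𝟙 (w′ Fin.≟ v) * 𝔸 u v) ⟨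
      _                 ≡⟨ sum-cong-≗ (λ v → distrib (𝔸 u v) (𝟙 (w Fin.≟ v)) (𝟙 (w′ Fin.≟ v))) ⟨
      (𝔸 ⊛ q) u         ∎
    x-null : IsNull G x
    x-null u = Null⇒≃0 {sum (λ v → adjacency G u v · x v)}
      (Null-cong (λ i → trans (row≡0 u) (sym (approx-adjacency x u i))) Null-0)

  -- The support compared with the swing vertices.

  module _ {K S y} (pivot : Pivot G K S y) where
    open Pivot pivot using (part)

    -- Null vectors vanish on `K` except possibly at `y`, which is swing; vertices of `S` outside
    -- `S*` are swing as well.
    Supp⊆S*⊎W : ∀ {v} → Supp G v → v ∈ S* G ⊎ v ∈ W G
    Supp⊆S*⊎W {v} (x , x-null , xv≄0) with either G part v | v Fin.≟ y
    ... | inj₂ v∈S | _        = ∈S⇒∈S*⊎∈W G part v∈S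
    ... | inj₁ _   | yes refl = inj₂ (y∈W G pivot)
    ... | inj₁ v∈K | no v≢y   = contradiction (null-on-clique pivot x-null v∈K v≢y) xv≄0

    -- Any second member of W can play the role of y.
    W-clique⇒W∩Supp≡∅ : IsClique G (W G) → 2 ≤ ∣ W G ∣ → ∀ {v} → v ∈ W G → ¬ Supp G v
    W-clique⇒W∩Supp≡∅ W-clique 2≤∣W∣ {v} v∈W (x , x-null , xv≄0)
      with w , w∈W , w≢v ← 2≤∣p∣⇒∃≢ 2≤∣W∣ v
      with W-shape G pivot
    ... | inj₁ W⊆K = xv≄0 (null-on-clique (∈W∩K⇒pivot G pivot w∈W (W⊆K w∈W)) x-null (W⊆K v∈W) (≢-sym w≢v))
    -- Impossible: `v` and `w` are adjacent in the clique, yet have equal neighbourhoods.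
    ... | inj₂ N≡  = ~-irrefl refl (∈N⁻ G (subst (w ∈_) (trans (N≡ v∈W) (sym (N≡ w∈W)))
                       (∈N⁺ G (W-clique v w v∈W w∈W (≢-sym w≢v)))))

    -- Two members of `W` cannot both lie in the clique `K`, so `W-shape` gives them equal
    -- neighbourhoods.
    W-independent⇒W⊆Supp : IsIndependent G (W G) → 2 ≤ ∣ W G ∣ → ∀ {v} → v ∈ W G → Supp G v
    W-independent⇒W⊆Supp W-indep 2≤∣W∣ {v} v∈W
      with w , w∈W , w≢v ← 2≤∣p∣⇒∃≢ 2≤∣W∣ v
      with W-shape G pivot
    ... | inj₁ W⊆K = contradiction
      (IsSPartition.clique part v w (W⊆K v∈W) (W⊆K w∈W) (≢-sym w≢v)) (W-indep v w v∈W w∈W)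
    ... | inj₂ N≡  = equal-neighbourhoods⇒supp (≢-sym w≢v) (trans (N≡ v∈W) (sym (N≡ w∈W)))

theorem4p12 : ∀ {n : ℕ} (G : Graph n) (sp : IsSplitGraph G) → Unbalanced G sp →
    (∀ v → v ∈ W G ⇔ deg G v ≡ ω G ∸ 1)
    × ((IsClique G (W G) ⊎ IsIndependent G (W G)) × (∀ u v → u ∈ W G → v ∈ W G → Twins G u v))
    × (∀ w → W G ≡ ⁅ w ⁆ → ∀ v → Supp G v → v ∈ S* G ∪ ⁅ w ⁆)
    × (IsClique G (W G) → 2 ≤ ∣ W G ∣ → (∀ v → Supp G v → v ∈ S* G) × (∀ v → ¬ (v ∈ W G × Supp G v)))
    × (IsIndependent G (W G) → 2 ≤ ∣ W G ∣ → (∀ v → v ∈ W G → Supp G v) × (∀ v → Supp G v → v ∈ S* G ∪ W G))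
theorem4p12 G sp unbalanced =
  let _ , _ , _ , pivot = ¬balanced⇒pivot G (IsSplitGraph.sPartition sp) unbalanced
      Supp⊆S*∪W = λ v v-supp → x∈p∪q⁺ (Supp⊆S*⊎W G pivot {v} v-supp)
  in
    (λ v → mk⇔ (∈W⇒deg≡ G) (deg≡⇒∈W G pivot))
  , (W-clique⊎independent G pivot , λ u v → twins G pivot)
  , (λ w W≡w v v-supp → subst (λ p → v ∈ S* G ∪ p) W≡w (Supp⊆S*∪W v v-supp))
  , (λ W-clique 2≤∣W∣ → let avoid = W-clique⇒W∩Supp≡∅ G pivot W-clique 2≤∣W∣ in
      (λ v v-supp → fromInj₁ (λ v∈W → contradiction v-supp (avoid v∈W)) (Supp⊆S*⊎W G pivot v-supp))
      , λ v (v∈W , v-supp) → avoid v∈W v-supp)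
  , (λ W-indep 2≤∣W∣ → (λ v → W-independent⇒W⊆Supp G pivot W-indep 2≤∣W∣) , Supp⊆S*∪W)
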